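{- Let $b \ge 2$ be an integer. (a) The positive integers with one or two base-$b$ digits that have two comma-children in base $b$ are precisely the numbers $w\cdot b + x$ with $0 \le w \le b-3$, $1 \le x \le \left\lfloor \frac{b-1}{2}\right\rfloor$ and $w = b-1-2x$. (b) The positive integers with three or more base-$b$ digits that have two comma-children in base $b$ are precisely the numbers whose base-$b$ representation is $$d\,(b-1)\,(b-1)\,\ldots\,(b-1)\,d\,(b-1-d),$$ that is, the digit $d$, followed by $i \ge 0$ digits equal to $b-1$, followed by the digit $d$, followed by the digit $b-1-d$, where $1 \le d \le b-2$.
   Context: Fix a base $b \ge 2$. A digit is any integer between $0$ and $b-1$. For a positive integer $n$, let $\delta(n)$ denote its leading (most significant, nonzero) base-$b$ digit. For positive integers $k, k'$, we say that $k'$ is a comma-child of $k$ (in base $b$) if $k' - k = d\cdot b + \delta(k')$, where $d = k \bmod b$ is the last base-$b$ digit of $k$. (A positive integer has at most two comma-children.) -}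

module Defs where

open import Data.Nat.Base
open import Data.Nat.Properties using (<⇒≤)
open import Data.Digit using (toNatDigits)
open import Data.List.Base using (List; head)
open import Data.Maybe.Base using (fromMaybe)
open import Data.Product using (_×_; ∃-syntax)
open import Data.Sum using (_⊎_)
open import Relation.Nullary.Decidable using (fromWitness)
open import Relation.Binary.PropositionalEquality using (_≡_; _≢_)

module _ (b : ℕ) .{{b≥2 : NonTrivial b}} where

  private instance
    b≢0 : NonZero b
    b≢0 = nonTrivial⇒nonZero b

  -- Most significant digit first, without leading zeros (0 itself is
  -- written with the single digit 0).
  digits : ℕ → List ℕ
  digits = toNatDigits b {fromWitness (<⇒≤ (nonTrivial⇒n>1 b))}

  -- The default 0 is never used, as digits n is never empty.
  δ : ℕ → ℕ
  δ n = fromMaybe 0 (head (digits n))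

  -- The defining equation k' - k = (k mod b) b + δ(k'), with k moved to the
  -- right so that no truncated subtraction occurs.
  CommaChild : (k k' : ℕ) → Set
  CommaChild k k' = 0 < k' × k' ≡ k + ((k % b) * b + δ k')

  -- Exactly two.
  HasTwoCommaChildren : ℕ → Set
  HasTwoCommaChildren k =
    ∃[ k₁ ] ∃[ k₂ ] k₁ ≢ k₂ × CommaChild k k₁ × CommaChild k k₂ ×
      (∀ k' → CommaChild k k' → k' ≡ k₁ ⊎ k' ≡ k₂)

{-# OPTIONS --safe #-}
-- Put c = k mod b and m = k + c b, so that the comma-children of k are the
-- numbers m + e with δ(m + e) = e.  If e₁ < e₂ both give children, then m + e₁
-- and m + e₂ are so close that they have the same number q + 1 of digits, and
-- comparing e₂ b^q ≤ m + e₂ with m + e₁ < (e₁ + 1) b^q forces e₂ = e₁ + 1 and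
-- m + e₂ = e₂ b^q, where q = p + 1 is positive.  Reducing modulo b gives
-- c = b - e₂, hence k = w b + c with w + c + 1 = e₂ b^p.  The case p = 0 is (a);
-- for p ≥ 1, subtracting c + 1 = b - e₁ from (e₁ + 1) b^p produces the digits
-- of (b).
module Submission where

open import Defs
open import Data.Nat using (ℕ; NonTrivial; _+_; _*_; _∸_; _≤_; _<_; ⌊_/2⌋)
open import Data.List.Base using (length; replicate; _∷_; []; _++_)
open import Data.Product using (_×_; ∃-syntax)
open import Function.Bundles using (_⇔_)
open import Relation.Binary.PropositionalEquality using (_≡_)

open import Data.Digit using (toNatDigits)
open import Data.List.Base using (List; foldl; _∷ʳ_)
open import Data.List.Properties using (++-assoc; foldl-∷ʳ; length-++)
open import Data.Nat
  using (zero; suc; pred; _^_; _/_; _%_; z<s; s≤s; z≤n; sz<ss; s≤s⁻¹; s<s⁻¹; NonZero;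
         nonTrivial⇒nonZero; nonTrivial⇒n>1; 2+; _<?_; >-nonZero; >-nonZero⁻¹)
open import Data.Nat.Divisibility using (_∣_; divides; ∣m+n∣m⇒∣n; n∣m*n)
open import Data.Nat.DivMod
open import Data.Nat.Induction using (Acc; acc; <-wellFounded-fast)
open import Data.Nat.Properties
open import Data.Nat.Tactic.RingSolver using (solve-∀)
open import Data.Product using (_,_; proj₁; proj₂)
open import Data.Sum using (_⊎_; inj₁; inj₂)
open import Data.Bool.Base using (true; false)
open import Function.Bundles using (mk⇔)
open import Relation.Binary.Definitions using (tri<; tri≈; tri>)
open import Relation.Binary.PropositionalEquality
  using (refl; sym; trans; cong; cong₂; subst; subst₂; module ≡-Reasoning)
open import Relation.Nullary using (¬_; yes; no; contradiction)
open import Relation.Nullary.Decidable using (does; dec-true; dec-false)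

-- Base-`b` expansions and the correctness of the digit conversion.

n≡n*1+0 : ∀ n → n ≡ n * 1 + 0
n≡n*1+0 = solve-∀

m*n*o≡m*[o*n] : ∀ e b P → e * P * b ≡ e * (b * P)
m*n*o≡m*[o*n] = solve-∀

replicate-∷ʳ : ∀ {A : Set} i {y : A} → replicate i y ∷ʳ y ≡ y ∷ replicate i y
replicate-∷ʳ zero = refl
replicate-∷ʳ (suc i) = cong (_ ∷_) (replicate-∷ʳ i)

-- The condition `0 < n` in `append` excludes leading zeros, while `single` still allows 0 to be
-- written as the digit 0. Growing the list at its low end matches repeated division by `b`.
data Expansion (b : ℕ) : ℕ → List ℕ → Set where
  single : ∀ {d} → d < b → Expansion b d (d ∷ [])
  append : ∀ {n ds d} → 0 < n → Expansion b n ds → d < b → Expansion b (n * b + d) (ds ∷ʳ d)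

module _ (b-2 : ℕ) where
  private b = 2+ b-2

  append-remainder : ∀ {n ds} → 0 < n / b → Expansion b (n / b) ds → Expansion b n (ds ∷ʳ n % b)
  append-remainder {n} {ds} q>0 e = subst (λ m → Expansion b m (ds ∷ʳ n % b))
    (sym (trans (m≡m%n+[m/n]*n n b) (+-comm (n % b) _))) (append q>0 e (m%n<n n b))

  single-remainder : ∀ {n} → ¬ 0 < n / b → Expansion b n (n % b ∷ [])
  single-remainder {n} q≯0 = subst (λ m → Expansion b m (n % b ∷ []))
    (m<n⇒m%n≡m (m/n≡0⇒m<n (n≤0⇒n≡0 (≮⇒≥ q≯0)))) (single (m%n<n n b))

  -- The loop of toNatDigits is local to that function and cannot be named.
  -- Here unification recovers it: its first argument is the predecessor of the
  -- number being converted, which the local loop carries along as a parameter.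
  mutual
    digitLoop : ℕ → {m : ℕ} → Acc _<_ m → List ℕ → List ℕ
    digitLoop n = _

    toNatDigits-digitLoop : ∀ n → 0 < n / b →
      ∃[ a ] toNatDigits b n ≡ digitLoop (pred n) {n / b} a (n % b ∷ [])
    toNatDigits-digitLoop n q>0 with <-wellFounded-fast n
    toNatDigits-digitLoop (suc n) q>0 | acc rs
      -- The conversion branches on this Boolean; replacing it by `true` lets the goal reduce to a
      -- call of the loop.
      with does (0 <? suc n / b) | dec-true (0 <? suc n / b) q>0
    -- Turning the arguments of that call into distinct variables leaves a pattern unification
    -- problem, which determines `digitLoop`.
    ... | true | refl with suc n / b | rs (m/n<m (suc n) b sz<ss) | suc n % b ∷ []
    ... | m | a | xs = a , refl

  -- Induction on the accessibility proof. The accumulator `xs` is arbitrary because each call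
  -- pushes a remainder onto it before continuing with the quotient.
  digitLoop-expansion : ∀ n {m} (a : Acc _<_ m) xs →
    ∃[ ds ] Expansion b m ds × digitLoop n a xs ≡ ds ++ xs
  digitLoop-expansion n {zero} a xs = 0 ∷ [] , single z<s , refl
  digitLoop-expansion n {suc m} (acc rs) xs with 0 <? suc m / b
  ... | no q≯0 with does (0 <? suc m / b) | dec-false (0 <? suc m / b) q≯0
  ... | false | refl = suc m % b ∷ [] , single-remainder q≯0 , refl
  digitLoop-expansion n {suc m} (acc rs) xs | yes q>0
    with ds , e , eq ← digitLoop-expansion n (rs (m/n<m (suc m) b sz<ss)) (suc m % b ∷ xs)
    with does (0 <? suc m / b) | dec-true (0 <? suc m / b) q>0
  ... | true | refl =
    ds ∷ʳ suc m % b , append-remainder q>0 e , trans eq (sym (++-assoc ds _ xs))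

  toNatDigits-expansion : ∀ n → Expansion b n (toNatDigits b n)
  toNatDigits-expansion n with 0 <? n / b
  ... | yes q>0
    with a , eq ← toNatDigits-digitLoop n q>0
    with ds , e , eq′ ← digitLoop-expansion (pred n) a (n % b ∷ []) =
    subst (Expansion b n) (sym (trans eq eq′)) (append-remainder q>0 e)
  toNatDigits-expansion zero | no q≯0 = single z<s
  toNatDigits-expansion (suc n) | no q≯0
    with does (0 <? suc n / b) | dec-false (0 <? suc n / b) q≯0
  ... | false | refl = single-remainder q≯0

digits-expansion : ∀ b .{{_ : NonTrivial b}} n → Expansion b n (digits b n)
digits-expansion (2+ b-2) = toNatDigits-expansion b-2

-- Uniqueness and value of expansions.

module _ (b : ℕ) .{{_ : NonTrivial b}} where

  private
    instance
      b≢0 : NonZero b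
      b≢0 = nonTrivial⇒nonZero b

    b>0 : 0 < b
    b>0 = >-nonZero⁻¹ b

  last-digit : ∀ w {x} → x < b → (w * b + x) % b ≡ x
  last-digit w {x} x<b = begin
    (w * b + x) % b  ≡⟨ cong (_% b) (+-comm (w * b) x) ⟩
    (x + w * b) % b  ≡⟨ [m+kn]%n≡m%n x w b ⟩
    x % b            ≡⟨ m<n⇒m%n≡m x<b ⟩
    x                ∎
    where open ≡-Reasoning

  divMod-unique : ∀ {u v x y} → x < b → y < b → u * b + x ≡ v * b + y → u ≡ v × x ≡ y
  divMod-unique {u} {v} {x} {y} x<b y<b eq = *-cancelʳ-≡ u v b u*b≡v*b , x≡y
    where
    x≡y : x ≡ y
    x≡y = trans (sym (last-digit u x<b)) (trans (cong (_% b) eq) (last-digit v y<b))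
    u*b≡v*b : u * b ≡ v * b
    u*b≡v*b = +-cancelʳ-≡ x (u * b) (v * b) (trans eq (cong (v * b +_) (sym x≡y)))

  b≤append : ∀ {n} d → 0 < n → b ≤ n * b + d
  b≤append {n} d n>0 = ≤-trans (m≤n*m b n {{>-nonZero n>0}}) (m≤m+n (n * b) d)

  -- The last digits agree by uniqueness of division with remainder, and lengths cannot differ
  -- because one digit stays below `b` and more digits reach `b`. The equation `m ≡ n` is a separate
  -- argument because indices of the form `n * b + d` cannot be unified by matching.
  expansion-functional : ∀ {m n ds es} → Expansion b m ds → Expansion b n es → m ≡ n → ds ≡ es
  expansion-functional (single _) (single _) refl = refl
  expansion-functional (single d<b) (append {d = y} n>0 _ _) eq =
    contradiction (subst (_< b) eq d<b) (≤⇒≯ (b≤append y n>0))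
  expansion-functional (append {d = x} n>0 _ _) (single d<b) eq =
    contradiction (subst (_< b) (sym eq) d<b) (≤⇒≯ (b≤append x n>0))
  expansion-functional (append {u} _ e x<b) (append {v} _ f y<b) eq
    with u≡v , x≡y ← divMod-unique {u} {v} x<b y<b eq =
    cong₂ _∷ʳ_ (expansion-functional e f u≡v) x≡y

  digits-unique : ∀ {n ds} → Expansion b n ds → digits b n ≡ ds
  digits-unique {n} e = expansion-functional (digits-expansion b n) e refl

  -- Horner's scheme; being a left inverse of `digits b`, it makes `digits b` injective.
  evaluate : List ℕ → ℕ
  evaluate = foldl (λ n d → n * b + d) 0

  evaluate-expansion : ∀ {n ds} → Expansion b n ds → evaluate ds ≡ n
  evaluate-expansion (single _) = refl
  evaluate-expansion (append {ds = ds} {d} _ e _) =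
    trans (foldl-∷ʳ _ 0 d ds) (cong (λ n → n * b + d) (evaluate-expansion e))

  digits-injective : ∀ {m n} → digits b m ≡ digits b n → m ≡ n
  digits-injective {m} {n} eq =
    trans (sym (evaluate-expansion (digits-expansion b m)))
      (trans (cong evaluate eq) (evaluate-expansion (digits-expansion b n)))

  -- The leading digit in terms of powers of `b`.

  record LeadingDigit (n e : ℕ) : Set where
    constructor leading
    field
      {power rest} : ℕ
      rest<power   : rest < b ^ power
      value        : n ≡ e * b ^ power + rest

  expansion⇒leadingDigit : ∀ {n ds} → Expansion b n ds → 0 < n →
    ∃[ e ] ∃[ es ] ds ≡ e ∷ es × 0 < e × e < b × LeadingDigit n e
  expansion⇒leadingDigit (single {d} d<b) n>0 =
    d , [] , refl , n>0 , d<b , leading {power = 0} z<s (n≡n*1+0 d)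
  expansion⇒leadingDigit (append {d = x} n>0 exp x<b) _
    with e , es , refl , e>0 , e<b , leading {p} {r} r<bᵖ refl ← expansion⇒leadingDigit exp n>0 =
    e , es ∷ʳ x , refl , e>0 , e<b , leading {power = suc p} rest<power (shift e b (b ^ p) r x)
    where
    shift : ∀ e b P r x → (e * P + r) * b + x ≡ e * (b * P) + (r * b + x)
    shift = solve-∀
    open ≤-Reasoning
    rest<power : r * b + x < b * b ^ p
    rest<power = begin-strict
      r * b + x  <⟨ +-monoʳ-< (r * b) x<b ⟩
      r * b + b  ≡⟨ +-comm (r * b) b ⟩
      suc r * b  ≤⟨ *-monoˡ-≤ b r<bᵖ ⟩
      b ^ p * b  ≡⟨ *-comm (b ^ p) b ⟩
      b * b ^ p  ∎

  -- Induction on `power`: a rest below `b ^ suc p` has quotient below `b ^ p`, so dividing by `b`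
  -- strips the last digit and keeps the leading one.
  leadingDigit⇒expansion : ∀ {n e} → 0 < e → e < b → LeadingDigit n e →
    ∃[ es ] Expansion b n (e ∷ es)
  leadingDigit⇒expansion e>0 e<b (leading {p} r<bᵖ refl) = go p r<bᵖ e>0 e<b
    where
    shift : ∀ e b P q s → (e * P + q) * b + s ≡ e * (b * P) + (s + q * b)
    shift = solve-∀
    go : ∀ p {r e} → r < b ^ p → 0 < e → e < b → ∃[ es ] Expansion b (e * b ^ p + r) (e ∷ es)
    go zero {zero} {e} _ e>0 e<b =
      [] , subst (λ n → Expansion b n (e ∷ [])) (n≡n*1+0 e) (single e<b)
    go zero {suc r} (s≤s ()) _ _
    go (suc p) {r} {e} r<b*bᵖ e>0 e<b
      with es , exp ← go p {r / b} (m<n*o⇒m/o<n (subst (r <_) (*-comm b (b ^ p)) r<b*bᵖ)) e>0 e<b =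
      es ∷ʳ r % b ,
      subst (λ n → Expansion b n (e ∷ es ∷ʳ r % b))
        (trans (shift e b (b ^ p) (r / b) (r % b))
          (cong (e * (b * b ^ p) +_) (sym (m≡m%n+[m/n]*n r b))))
        (append (<-≤-trans e>0 (≤-trans (m≤m*n e (b ^ p) {{m^n≢0 b p}}) (m≤m+n _ (r / b))))
          exp (m%n<n r b))

  -- Together with its converse `leadingDigit⇒δ`, this trades `δ` for inequalities between powers of
  -- `b`.
  δ-leadingDigit : ∀ {n} → 0 < n → 0 < δ b n × δ b n < b × LeadingDigit n (δ b n)
  δ-leadingDigit {n} n>0
    with e , es , eq , lead ← expansion⇒leadingDigit (digits-expansion b n) n>0
    rewrite eq = lead

  leadingDigit⇒δ : ∀ {n e} → 0 < e → e < b → LeadingDigit n e → δ b n ≡ e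
  leadingDigit⇒δ e>0 e<b lead
    with es , exp ← leadingDigit⇒expansion e>0 e<b lead
    rewrite digits-unique exp = refl

  -- Two nearby numbers with different leading digits.

  consecutive : ∀ {m d e} → 0 < m → 0 < d → d < e → e < b →
    LeadingDigit (m + d) d → LeadingDigit (m + e) e →
    e ≡ suc d × ∃[ p ] m + e ≡ e * b ^ suc p
  consecutive {m} {d} {e} m>0 d>0 d<e e<b (leading {p} {r} r<bᵖ m+d≡) (leading {q} {s} s<b^q m+e≡)
    = compare (<-cmp p q)
    where
    open ≤-Reasoning

    below : ∀ {n c i t} → n ≡ c * b ^ i + t → t < b ^ i → c < b → ∀ {j} → i < j → n < b ^ j
    below {n} {c} {i} {t} n≡ t<bⁱ c<b {j} i<j = begin-strict
      n              ≡⟨ n≡ ⟩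
      c * b ^ i + t  <⟨ +-monoʳ-< (c * b ^ i) t<bⁱ ⟩
      c * b ^ i + b ^ i ≡⟨ +-comm (c * b ^ i) (b ^ i) ⟩
      suc c * b ^ i  ≤⟨ *-monoˡ-≤ (b ^ i) c<b ⟩
      b ^ suc i      ≤⟨ ^-monoʳ-≤ b i<j ⟩
      b ^ j          ∎

    swap : ∀ m d e → m + e + d ≡ m + d + e
    swap = solve-∀

    compare : _ → e ≡ suc d × ∃[ p ] m + e ≡ e * b ^ suc p
    -- The smaller number would have more digits: `m + e < b ^ p ≤ m + d`.
    compare (tri> _ _ q<p) = contradiction m+e<m+d (<-asym (+-monoʳ-< m d<e))
      where
      m+e<m+d : m + e < m + d
      m+e<m+d = begin-strict
        m + e          <⟨ below m+e≡ s<b^q e<b q<p ⟩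
        b ^ p          ≤⟨ m≤n*m (b ^ p) d {{>-nonZero d>0}} ⟩
        d * b ^ p      ≤⟨ m≤m+n _ r ⟩
        d * b ^ p + r  ≡⟨ m+d≡ ⟨
        m + d          ∎
    -- Here `m + d < b ^ q` but `e * b ^ q ≤ m + e`, so the two would differ by more than
    -- `(e ∸ 1) * b ^ q`, which is at least `e ∸ d`.
    compare (tri< p<q _ _) = contradiction e*Q+d<Q+e (≤⇒≯ (no-overtake d<e))
      where
      Q = b ^ q
      e*Q+d<Q+e : e * Q + d < Q + e
      e*Q+d<Q+e = begin-strict
        e * Q + d        ≤⟨ +-monoˡ-≤ d (m≤m+n (e * Q) s) ⟩
        e * Q + s + d    ≡⟨ cong (_+ d) m+e≡ ⟨
        m + e + d        ≡⟨ swap m d e ⟩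
        m + d + e        <⟨ +-monoˡ-< e (below m+d≡ r<bᵖ (<-trans d<e e<b) p<q) ⟩
        Q + e            ∎
      no-overtake : ∀ {e} → d < e → Q + e ≤ e * Q + d
      no-overtake {suc x} _ = begin
        Q + suc x        ≡⟨ cong (Q +_) (+-comm 1 x) ⟩
        Q + (x + 1)      ≤⟨ +-monoʳ-≤ Q (+-mono-≤ (m≤m*n x Q {{m^n≢0 b q}}) d>0) ⟩
        Q + (x * Q + d)  ≡⟨ +-assoc Q (x * Q) d ⟨
        suc x * Q + d    ∎
    compare (tri≈ _ refl _)
      -- `g` is the excess of `e` over `suc d`, and `t` is the distance from `r` to its maximum
      -- `b ^ p ∸ 1`. Subtracting the two expansions yields `balance`.
      with g , refl ← m≤n⇒∃[o]m+o≡n d<e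
      with t , r+t≡P ← m≤n⇒∃[o]m+o≡n r<bᵖ = conclude p g refl refl balance
      where
      P = b ^ p
      regroup : ∀ d g P s → d * P + (P + (g * P + s)) + d ≡ (suc d + g) * P + s + d
      regroup = solve-∀
      regroup′ : ∀ D r d g → D + r + (suc d + g) ≡ D + (suc r + g) + d
      regroup′ = solve-∀
      spread : d * P + (P + (g * P + s)) ≡ d * P + (suc r + g)
      spread = +-cancelʳ-≡ d _ _ (begin-equality
        d * P + (P + (g * P + s)) + d  ≡⟨ regroup d g P s ⟩
        (suc d + g) * P + s + d        ≡⟨ cong (_+ d) m+e≡ ⟨
        m + (suc d + g) + d            ≡⟨ swap m d (suc d + g) ⟩
        m + d + (suc d + g)            ≡⟨ cong (_+ (suc d + g)) m+d≡ ⟩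
        d * P + r + (suc d + g)        ≡⟨ regroup′ (d * P) r d g ⟩
        d * P + (suc r + g) + d        ∎)
      balance : t + (g * P + s) ≡ g
      balance = +-cancelˡ-≡ (suc r) _ _ (begin-equality
        suc r + (t + (g * P + s))  ≡⟨ +-assoc (suc r) t _ ⟨
        suc r + t + (g * P + s)    ≡⟨ cong (_+ (g * P + s)) r+t≡P ⟩
        P + (g * P + s)            ≡⟨ +-cancelˡ-≡ (d * P) _ _ spread ⟩
        suc r + g                  ∎)
      -- For `p = 0` the number `m + d` would be the digit `d` itself. For positive `p`, `g * b ^ p`
      -- exceeds any positive `g`, so `g`, `t` and `s` all vanish. The split is on copies of `p` and
      -- `g`, since the facts above concern the originals.
      conclude : ∀ p′ g′ → p′ ≡ p → g′ ≡ g → t + (g * P + s) ≡ g →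
        suc d + g ≡ suc d × ∃[ i ] m + (suc d + g) ≡ (suc d + g) * b ^ suc i
      conclude zero g′ refl _ _ = contradiction (+-cancelʳ-≡ d m 0 m+d≡d) (>⇒≢ m>0)
        where
        m+d≡d : m + d ≡ d
        m+d≡d = begin-equality
          m + d      ≡⟨ m+d≡ ⟩
          d * 1 + r  ≡⟨ cong₂ _+_ (*-identityʳ d) (n<1⇒n≡0 r<bᵖ) ⟩
          d + 0      ≡⟨ +-identityʳ d ⟩
          d          ∎
      conclude (suc i) zero refl refl bal = +-identityʳ (suc d) , i ,
        trans m+e≡ (trans (cong ((suc d + 0) * P +_) (m+n≡0⇒n≡0 t bal)) (+-identityʳ _))
      conclude (suc i) (suc g′) refl refl bal = contradiction bal (>⇒≢ (begin-strict
        suc g′                   <⟨ m<m*n (suc g′) P (<-≤-trans (nonTrivial⇒n>1 b) (m≤m*n b (b ^ i) {{m^n≢0 b i}})) ⟩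
        suc g′ * P               ≤⟨ m≤m+n _ s ⟩
        suc g′ * P + s           ≤⟨ m≤n+m _ t ⟩
        t + (suc g′ * P + s)     ∎))

  -- The arithmetic condition equivalent to having two comma-children.

  -- In the notation of the header, x is c and d is e₁.
  record Critical (p k : ℕ) : Set where
    constructor critical
    field
      {w x d} : ℕ
      x>0     : 0 < x
      d>0     : 0 < d
      d+1+x≡b : suc d + x ≡ b
      k≡      : k ≡ w * b + x
      w+x+1≡  : w + suc x ≡ suc d * b ^ p

  -- Divisibility passes from `v * b` and `u * b` to `s`, and only one multiple of `b` lies strictly
  -- between 0 and `b + b`.
  multiple-below-2b : ∀ {u v s} → 0 < s → s < b + b → u * b + s ≡ v * b → s ≡ b
  multiple-below-2b {u} {v} {s} s>0 s<2b eq
    with ∣m+n∣m⇒∣n (subst (b ∣_) (sym eq) (n∣m*n v)) (n∣m*n u)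
  ... | divides zero refl = contradiction s>0 λ ()
  ... | divides (suc zero) s≡ = trans s≡ (+-identityʳ b)
  ... | divides (suc (suc i)) refl =
    contradiction s<2b (≤⇒≯ (+-monoʳ-≤ b (m≤m+n b (i * b))))

  -- The first two equations are stated for the given children because `critical⇒twoChildren` reuses
  -- them to exclude a third child.
  δ-ordered-children : ∀ k {k₁ k₂} → 0 < k → CommaChild b k k₁ → CommaChild b k k₂ →
    δ b k₁ < δ b k₂ →
    δ b k₂ ≡ suc (δ b k₁) × δ b k₂ + k % b ≡ b × ∃[ p ] k / b + suc (k % b) ≡ δ b k₂ * b ^ p
  δ-ordered-children k {k₁} {k₂} k>0 (k₁>0 , k₁≡) (k₂>0 , k₂≡) d<e
    with d>0 , _ , lead₁ ← δ-leadingDigit k₁>0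
    with e>0 , e<b , lead₂ ← δ-leadingDigit k₂>0
    with e≡1+d , p , m+e≡ ← consecutive (<-≤-trans k>0 (m≤m+n k (k % b * b))) d>0 d<e e<b
      (subst (λ n → LeadingDigit n (δ b k₁)) (trans k₁≡ (sym (+-assoc k _ _))) lead₁)
      (subst (λ n → LeadingDigit n (δ b k₂)) (trans k₂≡ (sym (+-assoc k _ _))) lead₂)
    = e≡1+d , e+c≡b , p , *-cancelʳ-≡ (w + suc c) (e * b ^ p) b w+c+1≡
    where
    open ≡-Reasoning
    w = k / b
    c = k % b
    e = δ b k₂
    regroup : ∀ w c b e → (w + c) * b + (e + c) ≡ c + w * b + c * b + e
    regroup = solve-∀
    regroup′ : ∀ w c b → (w + suc c) * b ≡ (w + c) * b + b
    regroup′ = solve-∀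
    -- The larger child, split so that its part outside the multiples of `b` is a sum `e + c` of two
    -- digits.
    multiple : (w + c) * b + (e + c) ≡ e * b ^ p * b
    multiple = begin
      (w + c) * b + (e + c)      ≡⟨ regroup w c b e ⟩
      c + w * b + c * b + e      ≡⟨ cong (λ n → n + c * b + e) (m≡m%n+[m/n]*n k b) ⟨
      k + c * b + e              ≡⟨ m+e≡ ⟩
      e * (b * b ^ p)            ≡⟨ m*n*o≡m*[o*n] e b (b ^ p) ⟨
      e * b ^ p * b              ∎
    e+c≡b : e + c ≡ b
    e+c≡b = multiple-below-2b {w + c} {e * b ^ p}
      (<-≤-trans e>0 (m≤m+n e c)) (+-mono-< e<b (m%n<n k b)) multiple
    -- The sum `e + c` is a full carry `b`, which raises `w + c` by one.
    w+c+1≡ : (w + suc c) * b ≡ e * b ^ p * b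
    w+c+1≡ = begin
      (w + suc c) * b        ≡⟨ regroup′ w c b ⟩
      (w + c) * b + b        ≡⟨ cong ((w + c) * b +_) e+c≡b ⟨
      (w + c) * b + (e + c)  ≡⟨ multiple ⟩
      e * b ^ p * b          ∎

  δ-ordered-children⇒critical : ∀ k {k₁ k₂} → 0 < k → CommaChild b k k₁ → CommaChild b k k₂ →
    δ b k₁ < δ b k₂ → ∃[ p ] Critical p k
  δ-ordered-children⇒critical k {k₁} {k₂} k>0 child₁ child₂ d<e =
    let e≡1+d , e+c≡b , p , w+c+1≡ = δ-ordered-children k k>0 child₁ child₂ d<e
        d>0 , _ = δ-leadingDigit (proj₁ child₁)
        _ , e<b , _ = δ-leadingDigit (proj₁ child₂)
    in p , critical {w = k / b}
      -- The last digit of `k` is positive because it completes `δ b k₂ < b` to `b`.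
      (+-cancelˡ-< (δ b k₂) 0 (k % b) (subst₂ _<_ (sym (+-identityʳ _)) (sym e+c≡b) e<b))
      d>0
      (trans (cong (_+ k % b) (sym e≡1+d)) e+c≡b)
      (trans (m≡m%n+[m/n]*n k b) (+-comm (k % b) _))
      (trans w+c+1≡ (cong (_* b ^ p) e≡1+d))

  -- A child is computed from `k` and its leading digit alone; hence distinct children can be
  -- ordered by leading digit.
  same-δ⇒same-child : ∀ k {k₁ k₂} → CommaChild b k k₁ → CommaChild b k k₂ →
    δ b k₁ ≡ δ b k₂ → k₁ ≡ k₂
  same-δ⇒same-child k (_ , k₁≡) (_ , k₂≡) eq =
    trans k₁≡ (trans (cong (λ e → k + (k % b * b + e)) eq) (sym k₂≡))

  twoChildren⇒critical : ∀ {k} → 0 < k → HasTwoCommaChildren b k → ∃[ p ] Critical p k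
  twoChildren⇒critical {k} k>0 (k₁ , k₂ , k₁≢k₂ , child₁ , child₂ , _) with <-cmp (δ b k₁) (δ b k₂)
  ... | tri< d<e _ _ = δ-ordered-children⇒critical k k>0 child₁ child₂ d<e
  ... | tri≈ _ d≡e _ = contradiction (same-δ⇒same-child k child₁ child₂ d≡e) k₁≢k₂
  ... | tri> _ _ e<d = δ-ordered-children⇒critical k k>0 child₂ child₁ e<d

  -- The larger child is `suc d * b ^ suc p` and the smaller is its predecessor, so the leading
  -- digit drops from `suc d` to `d` between them.
  critical⇒twoChildren : ∀ {p k} → Critical p k → HasTwoCommaChildren b k
  critical⇒twoChildren {p} {k} (critical {w} {x} {d} x>0 d>0 d+1+x≡b refl w+x+1≡) =
    k₁ , k₂ , <⇒≢ (+-monoʳ-< m (n<1+n d)) , child₁ , child₂ , only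
    where
    open ≡-Reasoning
    m k₁ k₂ B : ℕ
    m = w * b + x + x * b
    k₁ = m + d
    k₂ = m + suc d
    B = b ^ suc p
    1+d<b : suc d < b
    1+d<b = subst (suc d <_) d+1+x≡b (m<m+n (suc d) x>0)
    x<b : x < b
    x<b = subst (x <_) d+1+x≡b (m<n+m x z<s)
    regroup : ∀ w x b d → w * b + x + x * b + suc d ≡ (w + x) * b + (suc d + x)
    regroup = solve-∀
    regroup′ : ∀ w x b → (w + x) * b + b ≡ (w + suc x) * b
    regroup′ = solve-∀
    k₂≡ : k₂ ≡ suc d * B
    k₂≡ = begin
      w * b + x + x * b + suc d      ≡⟨ regroup w x b d ⟩
      (w + x) * b + (suc d + x)      ≡⟨ cong ((w + x) * b +_) d+1+x≡b ⟩
      (w + x) * b + b                ≡⟨ regroup′ w x b ⟩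
      (w + suc x) * b                ≡⟨ cong (_* b) w+x+1≡ ⟩
      suc d * b ^ p * b              ≡⟨ m*n*o≡m*[o*n] (suc d) b (b ^ p) ⟩
      suc d * B                      ∎
    B>0 : 0 < B
    B>0 = m^n>0 b (suc p)
    k₁≡ : k₁ ≡ d * B + pred B
    k₁≡ = suc-injective (begin
      suc (m + d)             ≡⟨ +-suc m d ⟨
      k₂                      ≡⟨ k₂≡ ⟩
      B + d * B               ≡⟨ +-comm B (d * B) ⟩
      d * B + B               ≡⟨ cong (d * B +_) (suc-pred B {{>-nonZero B>0}}) ⟨
      d * B + suc (pred B)    ≡⟨ +-suc (d * B) (pred B) ⟩
      suc (d * B + pred B)    ∎)
    δk₁ : δ b k₁ ≡ d
    δk₁ = leadingDigit⇒δ d>0 (<-trans (n<1+n d) 1+d<b)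
      (leading {power = suc p} (≤-reflexive (suc-pred B {{>-nonZero B>0}})) k₁≡)
    δk₂ : δ b k₂ ≡ suc d
    δk₂ = leadingDigit⇒δ z<s 1+d<b
      (leading {power = suc p} B>0 (trans k₂≡ (sym (+-identityʳ _))))
    k%b≡x : (w * b + x) % b ≡ x
    k%b≡x = last-digit w x<b
    child : ∀ {k′} e → δ b k′ ≡ e → 0 < e → k′ ≡ m + e → CommaChild b k k′
    child e δ≡ e>0 k′≡ = subst (0 <_) (sym k′≡) (<-≤-trans e>0 (m≤n+m e m)) ,
      trans k′≡ (trans (+-assoc (w * b + x) (x * b) e)
        (cong₂ (λ c e → w * b + x + (c * b + e)) (sym k%b≡x) (sym δ≡)))
    child₁ : CommaChild b k k₁
    child₁ = child d δk₁ d>0 refl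
    child₂ : CommaChild b k k₂
    child₂ = child (suc d) δk₂ z<s refl
    k>0 : 0 < k
    k>0 = <-≤-trans x>0 (m≤n+m x (w * b))
    -- A child with leading digit above `d` must have `suc d`. One below `d` would force
    -- `d + x ≡ b`, contradicting `suc d + x ≡ b`.
    only : ∀ k′ → CommaChild b k k′ → k′ ≡ k₁ ⊎ k′ ≡ k₂
    only k′ child′ with <-cmp (δ b k′) (δ b k₁)
    ... | tri≈ _ eq _ = inj₁ (same-δ⇒same-child k child′ child₁ eq)
    ... | tri> _ _ d<e = inj₂ (same-δ⇒same-child k child′ child₂
      (trans (proj₁ (δ-ordered-children k k>0 child₁ child′ d<e))
        (trans (cong suc δk₁) (sym δk₂))))
    ... | tri< e<d _ _ = contradiction (trans (sym δk₁) (+-cancelʳ-≡ (k % b) _ _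
      (trans (proj₁ (proj₂ (δ-ordered-children k k>0 child′ child₁ e<d)))
        (sym (trans (cong (suc d +_) k%b≡x) d+1+x≡b))))) (<⇒≢ (n<1+n d))

  -- The digits of critical numbers.

  suc-b∸1 : suc (b ∸ 1) ≡ b
  suc-b∸1 = m+[n∸m]≡n b>0

  -- Appending the digit `b ∸ 1` to `j` multiplies `suc j` by `b`.
  trailing-maximal : ∀ {d} i → 0 < d → d < b →
    ∃[ j ] 0 < j × suc j ≡ suc d * b ^ i × Expansion b j (d ∷ replicate i (b ∸ 1))
  trailing-maximal {d} zero d>0 d<b = d , d>0 , sym (*-identityʳ (suc d)) , single d<b
  trailing-maximal {d} (suc i) d>0 d<b with j , j>0 , 1+j≡ , exp ← trailing-maximal i d>0 d<b =
    j * b + (b ∸ 1) , <-≤-trans b>0 (b≤append (b ∸ 1) j>0) , 1+j′≡ ,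
    subst (λ ds → Expansion b (j * b + (b ∸ 1)) (d ∷ ds)) (replicate-∷ʳ i)
      (append j>0 exp (≤-reflexive suc-b∸1))
    where
    open ≡-Reasoning
    1+j′≡ : suc (j * b + (b ∸ 1)) ≡ suc d * b ^ suc i
    1+j′≡ = begin
      suc (j * b + (b ∸ 1))  ≡⟨ +-suc (j * b) (b ∸ 1) ⟨
      j * b + suc (b ∸ 1)    ≡⟨ cong (j * b +_) suc-b∸1 ⟩
      j * b + b              ≡⟨ +-comm (j * b) b ⟩
      suc j * b              ≡⟨ cong (_* b) 1+j≡ ⟩
      suc d * b ^ i * b      ≡⟨ m*n*o≡m*[o*n] (suc d) b (b ^ i) ⟩
      suc d * b ^ suc i      ∎

  -- Since `suc x` is `b ∸ d`, subtracting it from `suc d * b ^ suc i` borrows one from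
  -- `suc d * b ^ i` and leaves the last digit `d`; the borrow produces the digits `b ∸ 1`.
  critical-expansion : ∀ {d x} i → 0 < d → suc d + x ≡ b →
    ∃[ w ] w + suc x ≡ suc d * b ^ suc i ×
      Expansion b (w * b + x) (d ∷ replicate i (b ∸ 1) ++ d ∷ x ∷ [])
  critical-expansion {d} {x} i d>0 d+1+x≡b
    with j , j>0 , 1+j≡ , exp ← trailing-maximal i d>0 (m+n≤o⇒m≤o (suc d) (≤-reflexive d+1+x≡b)) =
    j * b + d , w+x+1≡ ,
    subst (λ ds → Expansion b ((j * b + d) * b + x) (d ∷ ds))
      (++-assoc (replicate i (b ∸ 1)) (d ∷ []) (x ∷ []))
      (append (<-≤-trans d>0 (m≤n+m d (j * b)))
        (append j>0 exp (m+n≤o⇒m≤o (suc d) (≤-reflexive d+1+x≡b)))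
        (subst (x <_) d+1+x≡b (m<n+m x z<s)))
    where
    open ≡-Reasoning
    regroup : ∀ n d x → n + d + suc x ≡ (suc d + x) + n
    regroup = solve-∀
    w+x+1≡ : j * b + d + suc x ≡ suc d * b ^ suc i
    w+x+1≡ = begin
      j * b + d + suc x      ≡⟨ regroup (j * b) d x ⟩
      (suc d + x) + j * b    ≡⟨ cong (_+ j * b) d+1+x≡b ⟩
      suc j * b              ≡⟨ cong (_* b) 1+j≡ ⟩
      suc d * b ^ i * b      ≡⟨ m*n*o≡m*[o*n] (suc d) b (b ^ i) ⟩
      suc d * b ^ suc i      ∎

  -- Critical numbers in the two explicit forms.

  ShortForm LongForm : ℕ → Set
  ShortForm k = ∃[ w ] ∃[ x ] k ≡ w * b + x × w + 3 ≤ b × 1 ≤ x × x ≤ ⌊ b ∸ 1 /2⌋ ×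
    w + (1 + 2 * x) ≡ b
  LongForm k = ∃[ d ] ∃[ i ] 1 ≤ d × d ≤ b ∸ 2 ×
    digits b k ≡ d ∷ replicate i (b ∸ 1) ++ d ∷ (b ∸ 1 ∸ d) ∷ []

  shortForm⇒critical : ∀ {k} → ShortForm k → Critical 0 k
  shortForm⇒critical {k} (w , suc y , k≡ , _ , _ , _ , w+1+2x≡b) =
    -- For exponent 0 the equation `w + suc x ≡ suc d` dictates `d = w + x`.
    critical {w = w} {x = suc y} {d = w + suc y} z<s (<-≤-trans z<s (m≤n+m (suc y) w))
      (trans (regroup w (suc y)) w+1+2x≡b) k≡ (trans (+-suc w (suc y)) (sym (*-identityʳ _)))
    where
    regroup : ∀ w x → suc (w + x) + x ≡ w + (1 + 2 * x)
    regroup = solve-∀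

  longForm⇒critical : ∀ {k} → LongForm k → ∃[ i ] Critical (suc i) k
  longForm⇒critical {k} (d , i , d>0 , d≤b∸2 , digits≡) =
    let w , w+x+1≡ , exp = critical-expansion i d>0 d+1+x≡b in
    -- `k` is known only through its digits; injectivity identifies it with the number built by
    -- `critical-expansion`.
    i , critical x>0 d>0 d+1+x≡b (digits-injective (trans digits≡ (sym (digits-unique exp)))) w+x+1≡
    where
    d+2≤b : d + 2 ≤ b
    d+2≤b = ≤-trans (+-monoˡ-≤ 2 d≤b∸2) (≤-reflexive (m∸n+n≡m (nonTrivial⇒n>1 b)))
    d<b∸1 : d < b ∸ 1
    d<b∸1 = s<s⁻¹ (subst₂ _≤_ (+-comm d 2) (sym suc-b∸1) d+2≤b)
    x>0 : 0 < b ∸ 1 ∸ d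
    x>0 = m<n⇒0<n∸m d<b∸1
    d+1+x≡b : suc d + (b ∸ 1 ∸ d) ≡ b
    d+1+x≡b = trans (cong suc (m+[n∸m]≡n (<⇒≤ d<b∸1))) suc-b∸1

  critical⇒shortForm : ∀ {k} → Critical 0 k → length (digits b k) ≤ 2 × ShortForm k
  critical⇒shortForm (critical {w} {x} {d} x>0 d>0 d+1+x≡b refl w+x+1≡) =
    short w w<b , w , x , refl , w+3≤b , x>0 , x≤⌊b∸1/2⌋ , w+1+2x≡b
    where
    open ≤-Reasoning
    regroup : ∀ w x → w + (1 + 2 * x) ≡ w + suc x + x
    regroup = solve-∀
    -- Eliminating `d` gives this equation; with `x>0` it yields both upper bounds.
    w+1+2x≡b : w + (1 + 2 * x) ≡ b
    w+1+2x≡b = trans (regroup w x)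
      (trans (cong (_+ x) (trans w+x+1≡ (*-identityʳ (suc d)))) d+1+x≡b)
    w+3≤b : w + 3 ≤ b
    w+3≤b = begin
      w + (1 + 2 * 1)  ≤⟨ +-monoʳ-≤ w (s≤s (*-monoʳ-≤ 2 x>0)) ⟩
      w + (1 + 2 * x)  ≡⟨ w+1+2x≡b ⟩
      b                ∎
    w<b : w < b
    w<b = <-≤-trans (m<m+n w z<s) w+3≤b
    x<b : x < b
    x<b = subst (x <_) d+1+x≡b (m<n+m x z<s)
    x≤⌊b∸1/2⌋ : x ≤ ⌊ b ∸ 1 /2⌋
    x≤⌊b∸1/2⌋ = begin
      x              ≡⟨ n≡⌊n+n/2⌋ x ⟩
      ⌊ x + x /2⌋    ≤⟨ ⌊n/2⌋-mono (s≤s⁻¹ (begin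
        suc (x + x)      ≡⟨ cong (λ y → suc (x + y)) (+-identityʳ x) ⟨
        1 + 2 * x        ≤⟨ m≤n+m _ w ⟩
        w + (1 + 2 * x)  ≡⟨ w+1+2x≡b ⟩
        b                ≡⟨ suc-b∸1 ⟨
        suc (b ∸ 1)      ∎)) ⟩
      ⌊ b ∸ 1 /2⌋    ∎
    -- The split on `w` is needed because `w = 0` is not written: the number then has a single
    -- digit.
    short : ∀ w → w < b → length (digits b (w * b + x)) ≤ 2
    short zero _ rewrite digits-unique (single x<b) = s≤s z≤n
    short w@(suc _) w<b rewrite digits-unique (append z<s (single w<b) x<b) = ≤-refl

  critical⇒longForm : ∀ {i k} → Critical (suc i) k → 3 ≤ length (digits b k) × LongForm k
  critical⇒longForm {i} (critical {w} {x} {d} x>0 d>0 d+1+x≡b refl w+x+1≡)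
    with w′ , w′+x+1≡ , exp ← critical-expansion i d>0 d+1+x≡b
    -- Both values satisfy the same equation, so the given `w` is the one whose digits are known.
    with refl ← +-cancelʳ-≡ (suc x) w w′ (trans w+x+1≡ (sym w′+x+1≡))
    = long , d , i , d>0 , d≤b∸2 ,
      trans digits≡ (cong (λ y → d ∷ replicate i (b ∸ 1) ++ d ∷ y ∷ []) x≡)
    where
    open ≤-Reasoning
    digits≡ : digits b (w * b + x) ≡ d ∷ replicate i (b ∸ 1) ++ d ∷ x ∷ []
    digits≡ = digits-unique exp
    x≡ : x ≡ b ∸ 1 ∸ d
    x≡ = sym (trans (cong (λ n → n ∸ 1 ∸ d) (sym d+1+x≡b)) (m+n∸m≡n d x))
    d≤b∸2 : d ≤ b ∸ 2
    d≤b∸2 = subst (_≤ b ∸ 2) (m+n∸n≡m d 2) (∸-monoˡ-≤ 2 (begin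
      d + 2        ≡⟨ +-suc d 1 ⟩
      suc d + 1    ≤⟨ +-monoʳ-≤ (suc d) x>0 ⟩
      suc d + x    ≡⟨ d+1+x≡b ⟩
      b            ∎))
    long : 3 ≤ length (digits b (w * b + x))
    long = begin
      suc 2                                               ≤⟨ s≤s (m≤n+m 2 (length (replicate i (b ∸ 1)))) ⟩
      suc (length (replicate i (b ∸ 1)) + 2)              ≡⟨ cong suc (length-++ (replicate i (b ∸ 1))) ⟨
      length (d ∷ replicate i (b ∸ 1) ++ d ∷ x ∷ [])      ≡⟨ cong length digits≡ ⟨
      length (digits b (w * b + x))                       ∎

  -- Separating the two cases by the number of digits.

  critical>0 : ∀ {p k} → Critical p k → 0 < k
  critical>0 (critical {w} {x} x>0 _ _ refl _) = <-≤-trans x>0 (m≤n+m x (w * b))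

theorem5p2 : (b : ℕ) .{{_ : NonTrivial b}} →
    (∀ (k : ℕ) →
    (0 < k × length (digits b k) ≤ 2 × HasTwoCommaChildren b k)
    ⇔
    (∃[ w ] ∃[ x ] k ≡ w * b + x × w + 3 ≤ b × 1 ≤ x × x ≤ ⌊ b ∸ 1 /2⌋ ×
    w + (1 + 2 * x) ≡ b))
    ×
    (∀ (k : ℕ) →
    (0 < k × 3 ≤ length (digits b k) × HasTwoCommaChildren b k)
    ⇔
    (∃[ d ] ∃[ i ] 1 ≤ d × d ≤ b ∸ 2 ×
    digits b k ≡ d ∷ replicate i (b ∸ 1) ++ d ∷ (b ∸ 1 ∸ d) ∷ []))
theorem5p2 b = (λ k → mk⇔ (short⇒ k) (short⇐ k)) , (λ k → mk⇔ (long⇒ k) (long⇐ k))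
  where
  short⇒ : ∀ k → 0 < k × length (digits b k) ≤ 2 × HasTwoCommaChildren b k → ShortForm b k
  short⇒ k (k>0 , len≤2 , two) with twoChildren⇒critical b k>0 two
  -- Exponent 0 gives at most two digits and a positive exponent at least three, so the length
  -- selects the form.
  ... | zero  , c = proj₂ (critical⇒shortForm b c)
  ... | suc _ , c = contradiction len≤2 (<⇒≱ (proj₁ (critical⇒longForm b c)))

  short⇐ : ∀ k → ShortForm b k → 0 < k × length (digits b k) ≤ 2 × HasTwoCommaChildren b k
  short⇐ k form = critical>0 b c , proj₁ (critical⇒shortForm b c) , critical⇒twoChildren b c
    where
    c : Critical b 0 k
    c = shortForm⇒critical b form

  long⇒ : ∀ k → 0 < k × 3 ≤ length (digits b k) × HasTwoCommaChildren b k → LongForm b k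
  long⇒ k (k>0 , len≥3 , two) with twoChildren⇒critical b k>0 two
  ... | zero  , c = contradiction (proj₁ (critical⇒shortForm b c)) (<⇒≱ len≥3)
  ... | suc _ , c = proj₂ (critical⇒longForm b c)

  long⇐ : ∀ k → LongForm b k → 0 < k × 3 ≤ length (digits b k) × HasTwoCommaChildren b k
  long⇐ k form = critical>0 b c , proj₁ (critical⇒longForm b c) , critical⇒twoChildren b c
    where
    c : Critical b _ k
    c = proj₂ (longForm⇒critical b form)
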